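{- Let $G$ be a directed graph on $[n]$ with $1$-transversal number $\tau_1$. Then \[ \lambda_M(G)\ \le\ n+\sum_{i=1}^{\tau_1}\lambda(i-1,\,n-\tau_1)\ \le\ \left(\frac{\tau_1^2}{2}+\frac{3\tau_1}{2}+1\right)n . \]
   Context: Graphs are directed and may contain loops. Write $[n]=\{1,\dots,n\}$. A $1$-feedback vertex set of $G$ is a set $I$ of vertices such that all cycles of the graph $G\setminus I$ (obtained by deleting $I$) are loops (cycles of length one); the $1$-transversal number of $G$ is the minimum size of a $1$-feedback vertex set. For integers $i\ge 0$, $\alpha\ge 0$, a word on $[\alpha+i]$ is $(i,\alpha)$-complete if it contains, as (not necessarily contiguous) subsequences, all permutations $j_1,\dots,j_{\alpha+i}$ of $[\alpha+i]$ such that for all $1\le\ell<\alpha+i$, if $j_\ell,j_{\ell+1}\in[\alpha]$ then $j_\ell<j_{\ell+1}$; $\lambda(i,\alpha)$ is the length of a shortest $(i,\alpha)$-complete word. An $n$-component (Boolean) network is a function $f=(f_1,\dots,f_n):\{0,1\}^n\to\{0,1\}^n$; its interaction graph is the directed graph on $[n]$ with an edge from $j$ to $i$ iff there exist $x,y$ differing only in component $j$ with $f_i(x)\ne f_i(y)$. It is monotone if $x\le y$ (componentwise) implies $f(x)\le f(y)$. For $i\in[n]$, $f^i(x):=(x_1,\dots,x_{i-1},f_i(x),x_{i+1},\dots,x_n)$, and for a word $w=i_1\dots i_k$ over $[n]$, $f^w:=f^{i_k}\circ\cdots\circ f^{i_1}$ (identity for the empty word). A word $w$ fixes $f$ if $f^w(x)$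 is a fixed point of $f$ for every $x$. $\lambda_M(G)$ is the minimum length of a single word over $[n]$ fixing every $n$-component monotone network whose interaction graph is a subgraph of $G$. -}

module Defs where

open import Level using (0ℓ)
open import Data.Bool.Base using (Bool) renaming (_≤_ to _≤ᵇ_)
open import Data.Fin.Base as Fin using (Fin; toℕ)
open import Data.Fin.Subset using (Subset; ∣_∣; _∉_)
open import Data.List.Base using (List; []; _∷_; _∷ʳ_; length; foldl; allFin)
open import Data.List.Relation.Binary.Permutation.Propositional using (_↭_)
open import Data.List.Relation.Binary.Sublist.Propositional using (_⊆_)
open import Data.List.Relation.Unary.Linked using (Linked)
open import Data.List.Relation.Unary.Unique.Propositional using (Unique)
open import Data.Nat.Base using (ℕ; _+_; _≤_; _<_)
open import Data.Nat.Properties using (≤-antisym)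
open import Data.Product.Base using (_×_; _,_; ∃₂; ∃-syntax)
open import Data.Vec.Base using (Vec; lookup; _[_]≔_)
open import Data.Vec.Relation.Binary.Pointwise.Inductive using (Pointwise)
open import Data.Empty using (⊥)
open import Relation.Binary.Core using (Rel; _⇒_; _Preserves_⟶_)
open import Relation.Binary.PropositionalEquality using (_≡_; _≢_)

infix 4 _IsMinimumOf_ _≤ᵛ_
infixl 6 _∖_

_IsMinimumOf_ : ℕ → (ℕ → Set) → Set
k IsMinimumOf P = P k × (∀ {m} → P m → k ≤ m)

minimum-unique : ∀ {P k l} → k IsMinimumOf P → l IsMinimumOf P → k ≡ l
minimum-unique (Pk , k≤) (Pl , l≤) = ≤-antisym (k≤ Pl) (l≤ Pk)

-- The set [n] is represented by Fin n, so j ∈ [n] corresponds to j - 1.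

Word : ℕ → Set
Word n = List (Fin n)

-- G j i means that there is an edge from j to i.
Digraph : ℕ → Set₁
Digraph n = Rel (Fin n) 0ℓ

IsSubgraph : ∀ {n} → Digraph n → Digraph n → Set
IsSubgraph H G = H ⇒ G

-- The vertices of I are kept, but isolated and without loops, so the cycles
-- are those of the graph on the remaining vertices.
_∖_ : ∀ {n} → Digraph n → Subset n → Digraph n
(G ∖ I) j i = j ∉ I × i ∉ I × G j i

IsCycle : ∀ {n} → Digraph n → List (Fin n) → Set
IsCycle G []       = ⊥
IsCycle G (v ∷ vs) = Unique (v ∷ vs) × Linked G (v ∷ vs ∷ʳ v)

IsFeedbackVertexSet₁ : ∀ {n} → Digraph n → Subset n → Set
IsFeedbackVertexSet₁ G I = ∀ c → IsCycle (G ∖ I) c → length c ≡ 1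

IsTransversalNumber₁ : ∀ {n} → Digraph n → ℕ → Set
IsTransversalNumber₁ G τ =
  τ IsMinimumOf λ k → ∃[ I ] IsFeedbackVertexSet₁ G I × ∣ I ∣ ≡ k

-- In Fin (α + i), the elements of [α] are those whose toℕ is below α.
AscendsWithin : ∀ {m} → ℕ → Rel (Fin m) 0ℓ
AscendsWithin α j k = toℕ j < α → toℕ k < α → j Fin.< k

IsComplete : (i α : ℕ) → Word (α + i) → Set
IsComplete i α w =
  ∀ p → p ↭ allFin (α + i) → Linked (AscendsWithin α) p → p ⊆ w

-- l is λ(i,α).
IsShortestCompleteLength : (i α l : ℕ) → Set
IsShortestCompleteLength i α l =
  l IsMinimumOf λ k → ∃[ w ] IsComplete i α w × length w ≡ k

State : ℕ → Set
State n = Vec Bool n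

Network : ℕ → Set
Network n = State n → State n

_≤ᵛ_ : ∀ {n} → Rel (State n) 0ℓ
_≤ᵛ_ = Pointwise _≤ᵇ_

Monotone : ∀ {n} → Network n → Set
Monotone f = f Preserves _≤ᵛ_ ⟶ _≤ᵛ_

DifferOnlyIn : ∀ {n} → Fin n → Rel (State n) 0ℓ
DifferOnlyIn j x y =
  lookup x j ≢ lookup y j × (∀ k → k ≢ j → lookup x k ≡ lookup y k)

interactionGraph : ∀ {n} → Network n → Digraph n
interactionGraph f j i =
  ∃₂ λ x y → DifferOnlyIn j x y × lookup (f x) i ≢ lookup (f y) i

update : ∀ {n} → Network n → Fin n → Network n
update f i x = x [ i ]≔ lookup (f x) i

-- The first letter of the word is applied first.
updates : ∀ {n} → Network n → Word n → Network n
updates f w x = foldl (λ y i → update f i y) x w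

Fixes : ∀ {n} → Word n → Network n → Set
Fixes w f = ∀ x → f (updates f w x) ≡ updates f w x

FixesMonotoneOn : ∀ {n} → Digraph n → Word n → Set
FixesMonotoneOn G w =
  ∀ f → Monotone f → IsSubgraph (interactionGraph f) G → Fixes w f

-- l is λ_M(G).
IsMonotoneFixingLength : ∀ {n} → Digraph n → ℕ → Set
IsMonotoneFixingLength G l =
  l IsMinimumOf λ k → ∃[ w ] FixesMonotoneOn G w × length w ≡ k

{-# OPTIONS --safe #-}
module Submission where

-- Delete a 1-feedback vertex set J = {v₁, …, v_τ}. What remains can be listed as
-- U so that no edge between distinct vertices leads backwards, and updating U in
-- this order makes it stable, since a monotone component only has positive loops.
--
-- Add the vertices of J one by one. Suppose a word makes U and v₁, …, vᵢ stable,
-- and update v = vᵢ₊₁ next. If v changes to the value b, then by monotonicity the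
-- system moves from there only towards b, so that every component changes at most
-- once and a word does at least as much as each of its subsequences. It therefore
-- suffices that the word used next contains one order of the letters that ends in
-- a stable state. Such an order is found greedily: run through U in its order
-- and then update some unstable vertex of J, again and again. The letters
-- of U between two letters of J come in the order of U, so this is one of the
-- permutations that an (i, α)-complete word contains.
--
-- The numerical bound needs only λ(i, α) ≤ (i + 1)(α + i): repeat the word
-- 1 … (α + i) for i + 1 times.

open import Defs
open import Data.Bool.Base as Bool using (Bool; true; false; if_then_else_)
import Data.Bool.Properties as Bool
open import Data.Fin.Base as Fin using (Fin; zero; suc; toℕ)
import Data.Fin.Properties as Fin
open import Data.Fin.Subset using (Subset; ∣_∣; inside; outside) renaming (_∉_ to _∉ˢ_)
open import Data.Fin.Subset.Properties using (_∈?_; drop-there; ∣p∣≤n)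
open import Data.Integer.Base as ℤ using (+_)
import Data.Integer.Properties as ℤ
open import Data.List.Base as List
  using (List; []; _∷_; [_]; _++_; map; filter; length; allFin; applyUpTo; concat; replicate; tabulate)
open import Data.List.Membership.Propositional using (_∈_; find)
open import Data.List.Membership.Propositional.Properties
  using (∈-∃++; ∈-filter⁺; ∈-++⁺ˡ; ∈-++⁺ʳ; ∈-++⁻; ∈-allFin; ∈-map⁺)
open import Data.List.Properties
  using (foldl-++; map-++; ++-assoc; ++-identityʳ; length-++; length-map; length-tabulate; length-filter;
         filter-accept; filter-reject; map-tabulate; map-applyUpTo; applyUpTo-∷ʳ)
open import Data.List.Relation.Binary.Permutation.Propositional
  using (_↭_; ↭-refl; ↭-sym; ↭-trans; ↭-reflexive; prep; ↭⇒↭ₛ)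
open import Data.List.Relation.Binary.Permutation.Propositional.Properties
  using (shift; drop-∷; ¬x∷xs↭[]; ↭-length; All-resp-↭; ∈-resp-↭; filter-↭; ++⁺; ++⁺ˡ; ++-comm)
import Data.List.Relation.Binary.Permutation.Setoid.Properties as Permutation
import Data.List.Relation.Binary.Sublist.DecPropositional as DecSublist
open import Data.List.Relation.Binary.Sublist.Propositional using (_⊆_; []; _∷_; _∷ʳ_; minimum)
import Data.List.Relation.Binary.Sublist.Propositional.Properties as Sublist
open import Data.List.Relation.Unary.All as All using (All; []; _∷_)
import Data.List.Relation.Unary.All.Properties as All
open import Data.List.Relation.Unary.AllPairs as AllPairs using (AllPairs; []; _∷_)
import Data.List.Relation.Unary.AllPairs.Properties as AllPairs
open import Data.List.Relation.Unary.Any as Any using (Any; here; there; any?)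
open import Data.List.Relation.Unary.Linked as Linked using (Linked; []; [-]; _∷_; linked?)
import Data.List.Relation.Unary.Linked.Properties as Linked
open import Data.List.Relation.Unary.Unique.Propositional using (Unique)
import Data.List.Relation.Unary.Unique.Propositional.Properties as Unique
open import Data.Maybe.Base using (just; nothing)
open import Data.Maybe.Relation.Binary.Connected using (Connected; just; nothing-just)
open import Data.Nat.Base using (ℕ; zero; suc; _+_; _*_; _∸_; _^_; _≤_; _<_; s<s; s<s⁻¹)
open import Data.Nat.Induction using (<-rec)
open import Data.Nat.ListAction using (sum)
open import Data.Nat.ListAction.Properties using (sum-++)
import Data.Nat.Properties as ℕ
open import Data.Nat.Solver using (module +-*-Solver)
open import Data.Product using (_×_; _,_; proj₁; proj₂; ∃; ∃-syntax; Σ-syntax)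
open import Data.Rational.Base as ℚ using (_/_; 1ℚ; toℚᵘ)
import Data.Rational.Properties as ℚ
open import Data.Rational.Unnormalised.Base as ℚᵘ using (mkℚᵘ)
import Data.Rational.Unnormalised.Properties as ℚᵘ
open import Data.Sum.Base as Sum using (_⊎_; inj₁; inj₂)
open import Data.Vec.Base as Vec using (Vec; []; _∷_; lookup; toList; fromList; _[_]≔_)
import Data.Vec.Properties as Vec
import Data.Vec.Relation.Binary.Pointwise.Inductive as Pointwise
import Data.Vec.Relation.Unary.All as VecAll
import Data.Vec.Relation.Unary.All.Properties as VecAll
open import Function.Base using (_∘_; _$_; id)
open import Level using (0ℓ)
open import Relation.Binary.Core using (Rel)
open import Relation.Binary.Definitions using (Decidable; DecidableEquality)
open import Relation.Binary.PropositionalEquality hiding ([_])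
open import Relation.Nullary using (¬_; Dec; yes; no; contradiction; ¬?)
open import Relation.Nullary.Decidable using (decidable-stable; _×-dec_; _→-dec_; map′)
open import Relation.Unary as Unary using (Pred)

-- Auxiliary facts about vectors, lists and sums

lookup-injective : ∀ {a} {A : Set a} {n} {xs ys : Vec A n} → (∀ i → lookup xs i ≡ lookup ys i) → xs ≡ ys
lookup-injective {xs = xs} {ys} eq =
  trans (sym (Vec.tabulate∘lookup xs)) (trans (Vec.tabulate-cong eq) (Vec.tabulate∘lookup ys))

≢⇒≡ : ∀ {b c d : Bool} → c ≢ b → d ≢ b → c ≡ d
≢⇒≡ c≢b d≢b = trans (Bool.¬-not c≢b) (sym (Bool.¬-not d≢b))

filter-++-filter : ∀ {a p} {A : Set a} {P : Pred A p} (P? : Unary.Decidable P) xs →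
  filter P? xs ++ filter (¬? ∘ P?) xs ↭ xs
filter-++-filter P? [] = ↭-refl
filter-++-filter P? (x ∷ xs) with P? x
... | yes _ = prep x (filter-++-filter P? xs)
... | no  _ = ↭-trans (shift x (filter P? xs) _) (prep x (filter-++-filter P? xs))

applyUpTo-cong : ∀ {A : Set} {g h : ℕ → A} → g ≗ h → ∀ k → applyUpTo g k ≡ applyUpTo h k
applyUpTo-cong g≗h zero    = refl
applyUpTo-cong g≗h (suc k) = cong₂ _∷_ (g≗h 0) (applyUpTo-cong (g≗h ∘ suc) k)

sum-applyUpTo-suc : ∀ g k → sum (applyUpTo g (suc k)) ≡ sum (applyUpTo g k) + g k
sum-applyUpTo-suc g k = begin
  sum (applyUpTo g (suc k))        ≡⟨ cong sum (applyUpTo-∷ʳ g k) ⟨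
  sum (applyUpTo g k ++ [ g k ])   ≡⟨ sum-++ (applyUpTo g k) [ g k ] ⟩
  sum (applyUpTo g k) + (g k + 0)  ≡⟨ cong (λ m → sum (applyUpTo g k) + m) (ℕ.+-identityʳ (g k)) ⟩
  sum (applyUpTo g k) + g k        ∎
  where open ≡-Reasoning

-- Monotone networks, stability and topological orders

-- For b = true this is the componentwise order, for b = false its converse:
-- every argument below thus covers at once the networks that increase and
-- those that decrease.
Below : Bool → ∀ {n} → Rel (State n) 0ℓ
Below b x y = ∀ i → lookup x i ≡ b → lookup y i ≡ b

Below-antisym : ∀ {b n} {x y : State n} → Below b x y → Below b y x → x ≡ y
Below-antisym {b} {x = x} {y} x≤y y≤x = lookup-injective eq
  where
  eq : ∀ i → lookup x i ≡ lookup y i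
  eq i with lookup x i Bool.≟ b
  ... | yes xi≡b = trans xi≡b (sym (x≤y i xi≡b))
  ... | no  xi≢b = ≢⇒≡ xi≢b (xi≢b ∘ y≤x i)

module _ {n : ℕ} where

  pointwise : ∀ {k} {x y : State k} → (∀ i → lookup x i Bool.≤ lookup y i) → x ≤ᵛ y
  pointwise {x = []}    {[]}    h = Pointwise.[]
  pointwise {x = _ ∷ _} {_ ∷ _} h = h zero Pointwise.∷ pointwise (h ∘ suc)

  Below-mono : ∀ {f : Network n} → Monotone f → ∀ {b x y} → Below b x y → Below b (f x) (f y)
  Below-mono mono {true} {x} {y} x≤y i fx≡b =
    ≤-true fx≡b (Pointwise.lookup (mono (pointwise (λ j → true-≤ (x≤y j)))) i)
    where
    ≤-true : ∀ {c d} → c ≡ true → c Bool.≤ d → d ≡ true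
    ≤-true refl Bool.b≤b = refl
    true-≤ : ∀ {c d} → (c ≡ true → d ≡ true) → c Bool.≤ d
    true-≤ {false} {false} h = Bool.b≤b
    true-≤ {false} {true}  h = Bool.f≤t
    true-≤ {true}  {d}     h rewrite h refl = Bool.b≤b
  Below-mono mono {false} {x} {y} x≤y i fx≡b =
    ≤-false fx≡b (Pointwise.lookup (mono (pointwise (λ j → false-≤ (x≤y j)))) i)
    where
    ≤-false : ∀ {c d} → d ≡ false → c Bool.≤ d → c ≡ false
    ≤-false refl Bool.b≤b = refl
    false-≤ : ∀ {c d} → (d ≡ false → c ≡ false) → c Bool.≤ d
    false-≤ {c}     {false} h rewrite h refl = Bool.b≤b
    false-≤ {false} {true}  h = Bool.f≤t
    false-≤ {true}  {true}  h = Bool.b≤b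

  Stable : Network n → State n → Fin n → Set
  Stable f x i = lookup (f x) i ≡ lookup x i

  -- To be read for `j` listed before `k`. With `j ≢ k` included, a list whose pairs all satisfy
  -- this has no repetitions; loops stay allowed.
  NoEdgeBack : Digraph n → Rel (Fin n) 0ℓ
  NoEdgeBack G j k = j ≢ k × ¬ G k j

  module _ (f : Network n) where

    update-at : ∀ i x → lookup (update f i x) i ≡ lookup (f x) i
    update-at i x = Vec.lookup∘update i x _

    update-off : ∀ {i k} x → k ≢ i → lookup (update f i x) k ≡ lookup x k
    update-off x k≢i = Vec.lookup∘update′ k≢i x _

    update-stable : ∀ {i x} → Stable f x i → update f i x ≡ x
    update-stable {i} {x} s = trans (cong (x [ i ]≔_) s) (Vec.[]≔-lookup x i)

    updates-stable : ∀ {w x} → All (Stable f x) w → updates f w x ≡ x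
    updates-stable [] = refl
    updates-stable {i ∷ w} {x} (s ∷ ss) rewrite update-stable {i} {x} s = updates-stable ss

    updates-++ : ∀ v w x → updates f (v ++ w) x ≡ updates f w (updates f v x)
    updates-++ v w x = foldl-++ _ x v w

    -- If `x` and `y` differ at `j`, a difference at `i` would witness the missing edge; otherwise
    -- they coincide.
    independent : ∀ {i j x y} → ¬ interactionGraph f j i →
      (∀ k → k ≢ j → lookup x k ≡ lookup y k) → lookup (f x) i ≡ lookup (f y) i
    independent {i} {j} {x} {y} noEdge x≈y with lookup x j Bool.≟ lookup y j
    ... | no xj≢yj = decidable-stable (_ Bool.≟ _) λ fx≢fy → noEdge (x , y , (xj≢yj , x≈y) , fx≢fy)
    ... | yes xj≡yj = cong (λ z → lookup (f z) i) (lookup-injective eq)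
      where
      eq : ∀ k → lookup x k ≡ lookup y k
      eq k with k Fin.≟ j
      ... | yes refl = xj≡yj
      ... | no k≢j   = x≈y k k≢j

  module _ {f : Network n} (mono : Monotone f) where

    -- If the update gives `i` a new value, the state moves towards this value, so by monotonicity
    -- `f` still asks for it. This is why loops are harmless.
    stable-at : ∀ i x → Stable f (update f i x) i
    stable-at i x with lookup x i Bool.≟ lookup (f x) i
    ... | yes xi≡fxi rewrite update-stable f {i} {x} (sym xi≡fxi) = sym xi≡fxi
    ... | no  xi≢fxi = trans (Below-mono mono below i refl) (sym (update-at f i x))
      where
      below : Below (lookup (f x) i) x (update f i x)
      below k xk≡b with k Fin.≟ i
      ... | yes refl = contradiction xk≡b xi≢fxi
      ... | no  k≢i  = trans (update-off f x k≢i) xk≡b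

    module _ {G : Digraph n} (sub : IsSubgraph (interactionGraph f) G) where

      stable-preserved : ∀ {i w x} → All (NoEdgeBack G i) w → Stable f x i → Stable f (updates f w x) i
      stable-preserved [] s = s
      stable-preserved {i} {j ∷ w} {x} ((i≢j , ¬ji) ∷ noBack) s = stable-preserved noBack (begin
        lookup (f (update f j x)) i ≡⟨ independent f (¬ji ∘ sub) (λ k k≢j → update-off f x k≢j) ⟩
        lookup (f x) i              ≡⟨ s ⟩
        lookup x i                  ≡⟨ update-off f x i≢j ⟨
        lookup (update f j x) i     ∎)
        where open ≡-Reasoning

      topological-stable : ∀ {w} → AllPairs (NoEdgeBack G) w → ∀ x → All (Stable f (updates f w x)) w
      topological-stable [] x = []
      topological-stable {i ∷ w} (noBack ∷ noBacks) x =
        stable-preserved noBack (stable-at i x) ∷ topological-stable noBacks (update f i x)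

    -- Networks that move towards one value

    module Propagation (b : Bool) where

      updates-mono : ∀ w {x y} → Below b x y → Below b (updates f w x) (updates f w y)
      updates-mono [] x≤y = x≤y
      updates-mono (i ∷ w) {x} {y} x≤y = updates-mono w below
        where
        below : Below b (update f i x) (update f i y)
        below k eq with k Fin.≟ i
        ... | yes refl = trans (update-at f i y) (Below-mono mono x≤y i (trans (sym (update-at f i x)) eq))
        ... | no k≢i   = trans (update-off f y k≢i) (x≤y k (trans (sym (update-off f x k≢i)) eq))

      -- Says that updating vertices of `S` can only turn values into `b`. This is an invariant of
      -- such updates: the state moves towards `b`, and `f` is monotone.
      Progressive : Pred (Fin n) 0ℓ → State n → Set
      Progressive S x = ∀ i → S i → lookup x i ≡ b → lookup (f x) i ≡ b

      module _ {S : Pred (Fin n) 0ℓ} where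

        update-grows : ∀ {i x} → S i → Progressive S x → Below b x (update f i x)
        update-grows {i} {x} i∈S prog k xk≡b with k Fin.≟ i
        ... | yes refl = trans (update-at f i x) (prog i i∈S xk≡b)
        ... | no  k≢i  = trans (update-off f x k≢i) xk≡b

        update-progressive : ∀ {i x} → S i → Progressive S x → Progressive S (update f i x)
        update-progressive {i} {x} i∈S prog k k∈S eq with k Fin.≟ i
        ... | yes refl = Below-mono mono (update-grows i∈S prog) i (trans (sym (update-at f i x)) eq)
        ... | no  k≢i  = Below-mono mono (update-grows i∈S prog) k (prog k k∈S (trans (sym (update-off f x k≢i)) eq))

        updates-progressive : ∀ {w x} → All S w → Progressive S x → Progressive S (updates f w x)
        updates-progressive [] prog = prog
        updates-progressive (i∈S ∷ w∈S) prog = updates-progressive w∈S (update-progressive i∈S prog)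

        updates-grow : ∀ {w x} → All S w → Progressive S x → Below b x (updates f w x)
        updates-grow [] prog k = id
        updates-grow (i∈S ∷ w∈S) prog k =
          updates-grow w∈S (update-progressive i∈S prog) k ∘ update-grows i∈S prog k

        -- A skipped letter moves the state towards `b`, and by monotonicity the letters after it
        -- preserve this advantage.
        updates-sublist : ∀ {v w x} → v ⊆ w → All S w → Progressive S x → Below b (updates f v x) (updates f w x)
        updates-sublist [] [] prog k = id
        updates-sublist {v} (i ∷ʳ v⊆w) (i∈S ∷ w∈S) prog k =
          updates-sublist v⊆w w∈S (update-progressive i∈S prog) k ∘ updates-mono v (update-grows i∈S prog) k
        updates-sublist (refl ∷ v⊆w) (i∈S ∷ w∈S) prog =
          updates-sublist v⊆w w∈S (update-progressive i∈S prog)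

        -- Both sides are the least state above x that is stable on the letters of w.
        sublist-stable : ∀ {v w x} → v ⊆ w → All S w → Progressive S x →
          All (Stable f (updates f v x)) w → updates f w x ≡ updates f v x
        sublist-stable {v} {w} {x} v⊆w w∈S prog stable =
          Below-antisym
            (λ k → subst (λ z → lookup z k ≡ b) (updates-stable f stable)
                 ∘ updates-mono w (updates-grow (Sublist.All-resp-⊆ v⊆w w∈S) prog) k)
            (updates-sublist v⊆w w∈S prog)

    -- Greedy construction of a stabilising order

    module Completion {G : Digraph n} (sub : IsSubgraph (interactionGraph f) G)
      (b : Bool) {m : ℕ} (α : ℕ) (σ : Fin m → Fin n)
      (topological : ∀ {j k} → toℕ j < α → toℕ k < α → j Fin.< k → NoEdgeBack G (σ j) (σ k))
      {S : Pred (Fin n) 0ℓ} (σ∈S : ∀ k → S (σ k)) where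

      open Propagation b

      Ascends : Rel (Fin m) 0ℓ
      Ascends = AscendsWithin α

      run : Word m → State n → State n
      run p = updates f (map σ p)

      run-++ : ∀ p q x → run (p ++ q) x ≡ run q (run p x)
      run-++ p q x = trans (cong (λ w → updates f w x) (map-++ σ p q)) (updates-++ f (map σ p) (map σ q) x)

      all-S : ∀ p → All S (map σ p)
      all-S p = All.map⁺ (All.universal σ∈S p)

      reached? : ∀ z → Unary.Decidable (λ k → lookup z (σ k) ≡ b)
      reached? z k = lookup z (σ k) Bool.≟ b

      -- A vertex without value `b` in the final state `z` never had it on the way, because `b` is
      -- never lost. Its updates therefore change nothing and can be left out.
      run-filter : ∀ p {x z} → Progressive S x → run p x ≡ z → run (filter (reached? z) p) x ≡ z
      run-filter [] prog eq = eq
      run-filter (k ∷ p) {x} {z} prog eq with reached? z k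
      ... | yes _ = run-filter p (update-progressive (σ∈S k) prog) eq
      ... | no zk≢b = subst (λ y → run (filter (reached? z) p) y ≡ z) y≡x
          (run-filter p (update-progressive (σ∈S k) prog) eq)
        where
        yk≢b : lookup (update f (σ k) x) (σ k) ≢ b
        yk≢b yk≡b = zk≢b (subst (λ y → lookup y (σ k) ≡ b) eq
          (updates-grow (all-S p) (update-progressive (σ∈S k) prog) (σ k) yk≡b))
        y≡x : update f (σ k) x ≡ x
        y≡x = update-stable f (≢⇒≡ (yk≢b ∘ trans (update-at f (σ k) x))
                                   (yk≢b ∘ update-grows (σ∈S k) prog (σ k)))

      Large : Pred (Fin m) 0ℓ
      Large k = ¬ (toℕ k < α)

      ascending-linked : ∀ {p} → AllPairs Fin._<_ p → Linked Ascends p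
      ascending-linked = Linked.map (λ j<k _ _ → j<k) ∘ Linked.AllPairs⇒Linked

      -- Only two adjacent small letters are constrained, so a large letter fits after and before
      -- any letter.
      linked-++-large : ∀ {p j q} → AllPairs Fin._<_ p → Large j → Linked Ascends (j ∷ q) →
        Linked Ascends (p ++ j ∷ q)
      linked-++-large asc large linked = Linked.++⁺ (ascending-linked asc) (to-large _) linked
        where
        to-large : ∀ x → Connected Ascends x (just _)
        to-large (just _) = just λ _ small → contradiction small large
        to-large nothing  = nothing-just

      large-∷-linked : ∀ {j q} → Large j → Linked Ascends q → Linked Ascends (j ∷ q)
      large-∷-linked large []        = [-]
      large-∷-linked large l@[-]     = (λ small _ → contradiction small large) ∷ l
      large-∷-linked large l@(_ ∷ _) = (λ small _ → contradiction small large) ∷ l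

      large-linked : ∀ {q} → All Large q → Linked Ascends q
      large-linked []               = []
      large-linked (large ∷ larges) = large-∷-linked large (large-linked larges)

      ascending-++-large : ∀ {p q} → AllPairs Fin._<_ p → All Large q → Linked Ascends (p ++ q)
      ascending-++-large {p} asc []            = subst (Linked _) (sym (++-identityʳ p)) (ascending-linked asc)
      ascending-++-large     asc large@(ℓ ∷ _) = linked-++-large asc ℓ (large-linked large)

      -- Invariant of the greedy construction: a letter that is no longer available names a vertex
      -- that already has the value `b`, which a progressive state keeps stable.
      Covers : Word m → Word m → State n → Set
      Covers p q x = ∀ k → k ∈ p ⊎ k ∈ q ⊎ lookup x (σ k) ≡ b

      unreached-∷ : ∀ {p q} q₁ {j q₂ x y z} → Below b x y → Below b y z → lookup z (σ j) ≡ b →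
        q ≡ q₁ ++ j ∷ q₂ → Covers p q x → Covers (filter (¬? ∘ reached? y) p) (q₁ ++ q₂) z
      unreached-∷ q₁ {y = y} x≤y y≤z zj≡b refl covers k with covers k | reached? y k
      ... | _                | yes yk≡b = inj₂ (inj₂ (y≤z (σ k) yk≡b))
      ... | inj₁ k∈p         | no yk≢b  = inj₁ (∈-filter⁺ (¬? ∘ reached? y) k∈p yk≢b)
      ... | inj₂ (inj₂ xk≡b) | no yk≢b  = contradiction (x≤y (σ k) xk≡b) yk≢b
      ... | inj₂ (inj₁ k∈q)  | no _     with ∈-++⁻ q₁ k∈q
      ...   | inj₁ k∈q₁         = inj₂ (inj₁ (∈-++⁺ˡ k∈q₁))
      ...   | inj₂ (here refl)  = inj₂ (inj₂ zj≡b)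
      ...   | inj₂ (there k∈q₂) = inj₂ (inj₁ (∈-++⁺ʳ q₁ k∈q₂))

      -- p and q hold the small and the large letters not used so far. Update all
      -- of p in ascending order; if some j in q is then unstable, keep only
      -- the letters of p that have changed, followed by j, and start again.
      stabilising-order : ∀ c p q {x} → length q ≡ c →
        AllPairs Fin._<_ p → All (λ k → toℕ k < α) p → All Large q →
        Progressive S x → Covers p q x →
        ∃[ r ] r ↭ p ++ q × Linked Ascends r × ∀ k → Stable f (run r x) (σ k)
      stabilising-order c p q {x} len asc small large prog covers = go c len
        -- In a progressive state an unstable vertex can only be one that is about to take the value
        -- `b`.
        (any? (λ j → ¬? (reached? y j) ×-dec (lookup (f y) (σ j) Bool.≟ b)) q)
        where
        y = run p x

        prog-y : Progressive S y
        prog-y = updates-progressive (all-S p) prog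

        reached-stable : ∀ {k} → lookup y (σ k) ≡ b → Stable f y (σ k)
        reached-stable {k} yk≡b = trans (prog-y (σ k) (σ∈S k) yk≡b) (sym yk≡b)

        noBack : ∀ {p} → AllPairs Fin._<_ p → All (λ k → toℕ k < α) p → AllPairs (NoEdgeBack G) (map σ p)
        noBack []         []             = []
        noBack (j< ∷ asc) (sj ∷ small) =
          All.map⁺ (All.zipWith (λ (j<k , sk) → topological sj sk j<k) (j< , small)) ∷ noBack asc small

        go : ∀ c → length q ≡ c → Dec (Any (λ j → lookup y (σ j) ≢ b × lookup (f y) (σ j) ≡ b) q) →
          ∃[ r ] r ↭ p ++ q × Linked Ascends r × ∀ k → Stable f (run r x) (σ k)
        -- `y` is stable already; the letters of `q` follow only to complete the permutation and
        -- change nothing.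
        go c len (no none) = p ++ q , ↭-refl , ascending-++-large asc large ,
          λ k → subst (λ z → Stable f z (σ k)) (sym run≡y) (stable-y k)
          where
          stable-y : ∀ k → Stable f y (σ k)
          stable-y k with covers k | reached? y k
          ... | _                | yes yk≡b = reached-stable yk≡b
          ... | inj₁ k∈p         | no _     =
            All.lookup (topological-stable sub (noBack asc small) x) (∈-map⁺ σ k∈p)
          ... | inj₂ (inj₁ k∈q)  | no yk≢b  =
            ≢⇒≡ (λ fy≡b → All.lookup (All.¬Any⇒All¬ q none) k∈q (yk≢b , fy≡b)) yk≢b
          ... | inj₂ (inj₂ xk≡b) | no yk≢b  = contradiction (updates-grow (all-S p) prog (σ k) xk≡b) yk≢b
          run≡y : run (p ++ q) x ≡ y
          run≡y = trans (run-++ p q x) (updates-stable f (All.map⁺ (All.universal stable-y q)))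
        go c len (yes found) = extend c len (find found)
          where
          extend : ∀ c → length q ≡ c → (∃[ j ] j ∈ q × lookup y (σ j) ≢ b × lookup (f y) (σ j) ≡ b) →
            ∃[ r ] r ↭ p ++ q × Linked Ascends r × ∀ k → Stable f (run r x) (σ k)
          extend c len (j , j∈q , yj≢b , fyj≡b) with ∈-∃++ j∈q
          -- `c` counts the large letters left and makes the recursion structural; as `j` is one of
          -- them, it is not zero.
          extend zero len _ | q₁ , q₂ , q≡ =
            contradiction (trans (sym (↭-length (↭-trans (↭-reflexive q≡) (shift _ q₁ q₂)))) len) λ ()
          extend (suc c) len (j , j∈q , yj≢b , fyj≡b) | q₁ , q₂ , q≡ =
            let r , r↭ , linked , stable = stabilising-order c unreached (q₁ ++ q₂) {z}
                  (ℕ.suc-injective (trans (sym (↭-length q↭)) len))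
                  (AllPairs.filter⁺ _ asc) (All.filter⁺ _ small) (All.tail large-∷)
                  (update-progressive (σ∈S j) prog-y)
                  (unreached-∷ {p} {q} q₁ {x = x} {y} {z} (updates-grow (all-S p) prog)
                    (update-grows (σ∈S j) prog-y) zj≡b q≡ covers)
            -- The letters of `p` that had no effect reappear in `r`, so that all of `p ++ q` is
            -- used.
            in reached ++ j ∷ r
             , ↭-trans (++⁺ˡ reached (↭-trans (prep j r↭) (↭-sym (shift j unreached (q₁ ++ q₂)))))
                 (↭-trans (↭-reflexive (sym (++-assoc reached unreached _)))
                   (++⁺ (filter-++-filter (reached? y) p) (↭-sym q↭)))
             , linked-++-large (AllPairs.filter⁺ _ asc) (All.head large-∷) (large-∷-linked (All.head large-∷) linked)
             , λ k → subst (λ u → Stable f u (σ k)) (sym (run≡ r)) (stable k)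
            where
            z = update f (σ j) y
            reached unreached : Word m
            reached   = filter (reached? y) p
            unreached = filter (¬? ∘ reached? y) p
            q↭ : q ↭ j ∷ q₁ ++ q₂
            q↭ = ↭-trans (↭-reflexive q≡) (shift j q₁ q₂)
            large-∷ : All Large (j ∷ q₁ ++ q₂)
            large-∷ = All-resp-↭ q↭ large
            zj≡b : lookup z (σ j) ≡ b
            zj≡b = trans (update-at f (σ j) y) fyj≡b
            run≡ : ∀ r → run (reached ++ j ∷ r) x ≡ run r z
            run≡ r = trans (run-++ reached (j ∷ r) x) (cong (run (j ∷ r)) (run-filter p prog refl))

      -- `ω` contains the order found greedily, which ends in a stable state, and extra letters
      -- cannot lead beyond that state.
      complete-stabilises : ∀ ω → (∀ p → p ↭ allFin m → Linked Ascends p → p ⊆ ω) →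
        ∀ {x} → Progressive S x → ∀ k → Stable f (run ω x) (σ k)
      complete-stabilises ω complete {x} prog k =
        let r , r↭ , linked , stable = stabilising-order _ smalls larges refl
              (AllPairs.filter⁺ small? (AllPairs.tabulate⁺-< id))
              (All.all-filter small? (allFin m))
              (All.all-filter (¬? ∘ small?) (allFin m))
              prog covers
            r⊆ω = Sublist.map⁺ σ (complete r (↭-trans r↭ (filter-++-filter small? (allFin m))) linked)
        in subst (λ z → Stable f z (σ k))
             (sym (sublist-stable r⊆ω (all-S ω) prog (All.map⁺ (All.universal stable ω)))) (stable k)
        where
        small? : Unary.Decidable (λ (k : Fin m) → toℕ k < α)
        small? k = toℕ k ℕ.<? α
        smalls larges : Word m
        smalls = filter small? (allFin m)
        larges = filter (¬? ∘ small?) (allFin m)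
        covers : Covers smalls larges x
        covers k with small? k
        ... | yes small = inj₁ (∈-filter⁺ small? (∈-allFin k) small)
        ... | no  large = inj₂ (inj₁ (∈-filter⁺ (¬? ∘ small?) (∈-allFin k) large))

-- Assembly of the fixing word, one feedback vertex at a time

AllPairs-lookup : ∀ {A : Set} {R : Rel A 0ℓ} {m} (xs : Vec A m) → AllPairs R (toList xs) →
  ∀ {j k} → j Fin.< k → R (lookup xs j) (lookup xs k)
AllPairs-lookup (x ∷ xs) (px ∷ _)   {zero}  {suc k} _   = VecAll.lookup⁺ (VecAll.toList⁻ px) k
AllPairs-lookup (x ∷ xs) (_  ∷ pxs) {suc j} {suc k} j<k = AllPairs-lookup xs pxs (s<s⁻¹ j<k)

module _ {n α : ℕ} (U : Vec (Fin n) α) (ω : ∀ i → Word (α + i)) where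

  -- The stage of `v` updates `v` once and then lets `ω i` act on `U` and the `i` earlier feedback
  -- vertices, `U` taking the letters below `α`. The last vertex added is the head of the vector.
  fixingWord : ∀ {i} → Vec (Fin n) i → Word n
  fixingWord []              = toList U
  fixingWord {suc i} (v ∷ K) = fixingWord K ++ v ∷ map (lookup (U Vec.++ K)) (ω i)

  length-fixingWord : ∀ {i} (K : Vec (Fin n) i) →
    length (fixingWord K) ≡ α + i + sum (applyUpTo (length ∘ ω) i)
  length-fixingWord [] = trans (Vec.length-toList U) (solve 1 (λ a → a := a :+ con 0 :+ con 0) refl α)
    where open +-*-Solver
  length-fixingWord {suc i} (v ∷ K) = begin
    length (fixingWord K ++ v ∷ map σ (ω i))
      ≡⟨ length-++ (fixingWord K) ⟩
    length (fixingWord K) + suc (length (map σ (ω i)))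
      ≡⟨ cong₂ _+_ (length-fixingWord K) (cong suc (length-map σ (ω i))) ⟩
    α + i + s + suc l
      ≡⟨ solve 4 (λ a i s l → a :+ i :+ s :+ (con 1 :+ l) := a :+ (con 1 :+ i) :+ (s :+ l)) refl α i s l ⟩
    α + suc i + (s + l)
      ≡⟨ cong (λ t → α + suc i + t) (sum-applyUpTo-suc (length ∘ ω) i) ⟨
    α + suc i + sum (applyUpTo (length ∘ ω) (suc i)) ∎
    where
    open ≡-Reasoning
    open +-*-Solver
    σ = lookup (U Vec.++ K)
    s = sum (applyUpTo (length ∘ ω) i)
    l = length (ω i)

  module _ (complete : ∀ i → IsComplete i α (ω i)) {G : Digraph n} (topU : AllPairs (NoEdgeBack G) (toList U))
    {f : Network n} (mono : Monotone f) (sub : IsSubgraph (interactionGraph f) G) where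

    -- Induction on the feedback vertices. The value `b` that `v` receives sets the direction: the
    -- vertices stable before can from then on only move towards `b`, and `ω i` makes them stable
    -- again.
    fixingWord-stable : ∀ {i} (K : Vec (Fin n) i) x → let z = updates f (fixingWord K) x in
      VecAll.All (Stable f z) U × VecAll.All (Stable f z) K
    fixingWord-stable [] x = VecAll.toList⁻ (topological-stable mono sub topU x) , VecAll.[]
    fixingWord-stable {suc i} (v ∷ K) x
      rewrite updates-++ f (fixingWord K) (v ∷ map (lookup (U Vec.++ K)) (ω i)) x =
      let stableU , stableK = VecAll.++⁻ U (VecAll.lookup⁻ stable) in stableU , stable-v VecAll.∷ stableK
      where
      y = updates f (fixingWord K) x
      b = lookup (f y) v
      z = update f v y
      σ = lookup (U Vec.++ K)
      open Propagation mono b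

      -- Including `v` makes its progress part of the invariant: it keeps `b` during `ω i` and is
      -- stable at the end.
      S : Pred (Fin n) 0ℓ
      S u = u ≡ v ⊎ ∃[ k ] u ≡ σ k

      σ∈S : ∀ k → S (σ k)
      σ∈S k = inj₂ (k , refl)

      stable-y : ∀ k → Stable f y (σ k)
      stable-y = let stableU , stableK = fixingWord-stable K x in VecAll.lookup⁺ (VecAll.++⁺ stableU stableK)

      -- Holds at v by the choice of b, whether or not v changes.
      prog-y : Progressive S y
      prog-y _ (inj₁ refl)       _    = refl
      prog-y _ (inj₂ (k , refl)) yk≡b = trans (stable-y k) yk≡b

      prog-z : Progressive S z
      prog-z = update-progressive (inj₁ refl) prog-y

      topological : ∀ {j k} → toℕ j < α → toℕ k < α → j Fin.< k → NoEdgeBack G (σ j) (σ k)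
      topological {j} {k} j<α k<α j<k =
        subst₂ (NoEdgeBack G) (sym (Vec.lookup-++-< U K j j<α)) (sym (Vec.lookup-++-< U K k k<α))
          (AllPairs-lookup U topU (subst₂ _<_ (sym (Fin.toℕ-fromℕ< j<α)) (sym (Fin.toℕ-fromℕ< k<α)) j<k))

      open Completion mono sub b α σ topological {S} σ∈S

      stable : ∀ k → Stable f (run (ω i) z) (σ k)
      stable = complete-stabilises (ω i) (complete i) prog-z

      stable-v : Stable f (run (ω i) z) v
      stable-v = trans (updates-progressive (all-S (ω i)) prog-z v (inj₁ refl) reached-v) (sym reached-v)
        where
        reached-v : lookup (run (ω i) z) v ≡ b
        reached-v = updates-grow (all-S (ω i)) prog-z v (update-at f v y)

-- Topological sorting outside a feedback vertex set

Linked-∷ʳ⁻ : ∀ {A : Set} {R : Rel A 0ℓ} xs {u ys} → Linked R (xs ++ u ∷ ys) → Linked R (xs List.∷ʳ u)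
Linked-∷ʳ⁻ []           _        = [-]
Linked-∷ʳ⁻ (x ∷ [])     (r ∷ _)  = r ∷ [-]
Linked-∷ʳ⁻ (x ∷ y ∷ xs) (r ∷ rs) = r ∷ Linked-∷ʳ⁻ (y ∷ xs) rs

Unique-resp-↭ : ∀ {A : Set} {xs ys : List A} → xs ↭ ys → Unique xs → Unique ys
Unique-resp-↭ xs↭ys = Permutation.Unique-resp-↭ (setoid _) (↭⇒↭ₛ xs↭ys)

Unique-++⁻ˡ : ∀ {A : Set} (xs : List A) {ys} → Unique (xs ++ ys) → Unique xs
Unique-++⁻ˡ []       _         = []
Unique-++⁻ˡ (x ∷ xs) (x∉ ∷ uq) = All.++⁻ˡ xs x∉ ∷ Unique-++⁻ˡ xs uq

module _ {n : ℕ} {G : Digraph n} (G? : Decidable G) {I : Subset n} (feedback : IsFeedbackVertexSet₁ G I) where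

  -- Walk backwards along edges: ps has been visited, rest has not. The walk
  -- cannot return to ps, as this would close a cycle of length at least two.
  source-from : ∀ c ps rest {v S} → length rest ≡ c → S ↭ v ∷ ps ++ rest → Unique S → All (_∉ˢ I) S →
    Linked (G ∖ I) (v ∷ ps) → ∃[ s ] s ∈ S × All (λ u → s ≢ u → ¬ G u s) S
  source-from c ps rest {v} {S} len S↭ uq S∉I linked
    with any? (λ u → ¬? (v Fin.≟ u) ×-dec G? u v) S
  ... | no none = v , ∈-resp-↭ (↭-sym S↭) (here refl) ,
    All.map (λ ¬both v≢u Guv → ¬both (v≢u , Guv)) (All.¬Any⇒All¬ S none)
  ... | yes found with find found
  ...   | u , u∈S , v≢u , Guv with ∈-++⁻ (v ∷ ps) (∈-resp-↭ S↭ u∈S)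
  ...     | inj₁ (here refl) = contradiction refl v≢u
  ...     | inj₁ (there u∈ps) = contradiction (feedback (u ∷ v ∷ proj₁ split) cycle) λ ()
    where
    split = ∈-∃++ u∈ps
    as = proj₁ split
    bs = proj₁ (proj₂ split)
    ps≡ : ps ≡ as ++ u ∷ bs
    ps≡ = proj₂ (proj₂ split)
    edge : (G ∖ I) u v
    edge = All.lookup S∉I u∈S , All.lookup S∉I (∈-resp-↭ (↭-sym S↭) (here refl)) , Guv
    cycle : IsCycle (G ∖ I) (u ∷ v ∷ as)
    cycle = Unique-++⁻ˡ (u ∷ v ∷ as) (Unique-resp-↭ (shift u (v ∷ as) bs)
              (subst (λ xs → Unique (v ∷ xs)) ps≡ (Unique-++⁻ˡ (v ∷ ps) (Unique-resp-↭ S↭ uq))))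
          , edge ∷ Linked-∷ʳ⁻ (v ∷ as) (subst (λ xs → Linked (G ∖ I) (v ∷ xs)) ps≡ linked)
  source-from c ps rest {v} {S} len S↭ uq S∉I linked | yes found | u , u∈S , v≢u , Guv | inj₂ u∈rest
    with ∈-∃++ u∈rest
  -- Splitting `as` exposes the list as nonempty, which contradicts length zero.
  source-from zero    ps _ () _ _ _ _ | yes _ | _ | inj₂ _ | []    , bs , refl
  source-from zero    ps _ () _ _ _ _ | yes _ | _ | inj₂ _ | _ ∷ _ , bs , refl
  source-from (suc c) ps rest {v} len S↭ uq S∉I linked | yes _ | u , u∈S , v≢u , Guv | inj₂ _ | as , bs , refl =
    source-from c (v ∷ ps) (as ++ bs)
      (ℕ.suc-injective (trans (sym (↭-length (shift u as bs))) len))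
      (↭-trans S↭ (↭-trans (++⁺ˡ (v ∷ ps) (shift u as bs)) (shift u (v ∷ ps) (as ++ bs))))
      uq S∉I
      ((All.lookup S∉I u∈S , All.lookup S∉I (∈-resp-↭ (↭-sym S↭) (here refl)) , Guv) ∷ linked)

  -- A vertex that no other vertex points to is put first, and the remaining ones are sorted in the
  -- same way. The length `c` makes the recursion structural.
  topologicalSort : ∀ c S → length S ≡ c → Unique S → All (_∉ˢ I) S → ∃[ U ] U ↭ S × AllPairs (NoEdgeBack G) U
  topologicalSort c       []          len uq S∉I = [] , ↭-refl , []
  topologicalSort (suc c) S@(v ∷ rest) len uq S∉I =
    let s , s∈S , source = source-from _ [] rest refl ↭-refl uq S∉I [-]
        as , bs , S≡ = ∈-∃++ s∈S
        S↭ = ↭-trans (↭-reflexive S≡) (shift s as bs)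
        uq∷ = Unique-resp-↭ S↭ uq
        U , U↭ , top = topologicalSort c (as ++ bs) (ℕ.suc-injective (trans (sym (↭-length S↭)) len))
          (AllPairs.tail uq∷) (All.tail (All-resp-↭ S↭ S∉I))
    in s ∷ U , ↭-trans (prep s U↭) (↭-sym S↭)
     , All-resp-↭ (↭-sym U↭) (All.zipWith (λ (s≢u , noEdge) → s≢u , noEdge s≢u)
         (AllPairs.head uq∷ , All.tail (All-resp-↭ S↭ source))) ∷ top

-- Counting the members of a subset

length-filter-map : ∀ {A B : Set} {P : Pred B 0ℓ} {Q : Pred A 0ℓ}
  (P? : Unary.Decidable P) (Q? : Unary.Decidable Q) (f : A → B) →
  (∀ {x} → P (f x) → Q x) → (∀ {x} → Q x → P (f x)) → ∀ xs →
  length (filter P? (map f xs)) ≡ length (filter Q? xs)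
length-filter-map P? Q? f to from [] = refl
length-filter-map P? Q? f to from (x ∷ xs) with P? (f x) | Q? x
... | yes _ | yes _ = cong suc (length-filter-map P? Q? f to from xs)
... | no _  | no _  = length-filter-map P? Q? f to from xs
... | yes p | no ¬q = contradiction (to p) ¬q
... | no ¬p | yes q = contradiction (from q) ¬p

length-filter-∈ : ∀ {n} (p : Subset n) → length (filter (_∈? p) (allFin n)) ≡ ∣ p ∣
length-filter-∈ []      = refl
length-filter-∈ {suc n} (s ∷ p) with step s
  where
  step : ∀ s → length (filter (_∈? (s ∷ p)) (tabulate suc)) ≡ ∣ p ∣
  step s = trans (cong (length ∘ filter (_∈? (s ∷ p))) (sym (map-tabulate id suc)))
    (trans (length-filter-map (_∈? (s ∷ p)) (_∈? p) suc drop-there Vec.there (allFin n)) (length-filter-∈ p))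
length-filter-∈ (inside  ∷ p) | eq = cong suc eq
length-filter-∈ (outside ∷ p) | eq = eq

-- Decidability by finite search and existence of minima

-- Finiteness without an enumeration. It passes to products, vectors and tables, and is what
-- produces λ and λ_M as actual minima.
Searchable : Set → Set₁
Searchable A = ∀ {P : Pred A 0ℓ} → Unary.Decidable P → Dec (∃ P)

module _ {A : Set} (search : Searchable A) where

  all-dec : ∀ {P : Pred A 0ℓ} → Unary.Decidable P → Dec (∀ x → P x)
  all-dec P? = map′ (λ ¬∃¬ x → decidable-stable (P? x) λ ¬Px → ¬∃¬ (x , ¬Px))
    (λ ∀P (x , ¬Px) → ¬Px (∀P x)) (¬? (search (¬? ∘ P?)))

  search-× : ∀ {B} → Searchable B → Searchable (A × B)
  search-× search′ P? = map′ (λ (x , y , p) → (x , y) , p) (λ ((x , y) , p) → x , y , p)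
    (search λ x → search′ λ y → P? (x , y))

  search-Vec : ∀ n → Searchable (Vec A n)
  search-Vec zero    P? = map′ ([] ,_) (λ { ([] , p) → p }) (P? [])
  search-Vec (suc n) P? = map′ (λ (x , xs , p) → x ∷ xs , p) (λ { (x ∷ xs , p) → x , xs , p })
    (search λ x → search-Vec n λ xs → P? (x ∷ xs))

search-Bool : Searchable Bool
search-Bool P? with P? false | P? true
... | yes p | _     = yes (false , p)
... | no _  | yes p = yes (true , p)
... | no ¬f | no ¬t = no λ { (false , p) → ¬f p ; (true , p) → ¬t p }

search-State : ∀ n → Searchable (State n)
search-State = search-Vec search-Bool

-- Truth tables. Functions on State n cannot be enumerated up to ≡, only up to pointwise equality.
Table : ℕ → Set → Set
Table zero    A = A
Table (suc n) A = Table n (A × A)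

⟦_⟧ : ∀ {n A} → Table n A → State n → A
⟦_⟧ {zero}  t []      = t
⟦_⟧ {suc n} t (b ∷ x) = (if b then proj₁ else proj₂) (⟦ t ⟧ x)

table : ∀ {n A} → (State n → A) → Table n A
table {zero}  g = g []
table {suc n} g = table λ x → g (true ∷ x) , g (false ∷ x)

⟦table⟧ : ∀ {n A} (g : State n → A) → ⟦ table g ⟧ ≗ g
⟦table⟧ {zero}  g []          = refl
⟦table⟧ {suc n} g (true ∷ x)  = cong proj₁ (⟦table⟧ (λ x → g (true ∷ x) , g (false ∷ x)) x)
⟦table⟧ {suc n} g (false ∷ x) = cong proj₂ (⟦table⟧ (λ x → g (true ∷ x) , g (false ∷ x)) x)

search-Table : ∀ n {A} → Searchable A → Searchable (Table n A)
search-Table zero    search = search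
search-Table (suc n) search = search-Table n (search-× search search)

module _ {n : ℕ} where

  _≟ᵛ_ : DecidableEquality (State n)
  _≟ᵛ_ = Vec.≡-dec Bool._≟_

  monotone? : ∀ f → Dec (Monotone {n} f)
  monotone? f = map′ (λ mono {x} {y} → mono x y) (λ mono x y → mono {x} {y})
    (all-dec (search-State n) λ x → all-dec (search-State n) λ y →
      Pointwise.decidable Bool._≤?_ x y →-dec Pointwise.decidable Bool._≤?_ (f x) (f y))

  interactionGraph? : ∀ f → Decidable (interactionGraph {n} f)
  interactionGraph? f j i = search-State n λ x → search-State n λ y →
    (¬? (lookup x j Bool.≟ lookup y j) ×-dec
      Fin.all? λ k → ¬? (k Fin.≟ j) →-dec (lookup x k Bool.≟ lookup y k)) ×-dec
    ¬? (lookup (f x) i Bool.≟ lookup (f y) i)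

  subgraph? : ∀ {H G : Digraph n} → Decidable H → Decidable G → Dec (IsSubgraph H G)
  subgraph? H? G? = map′ (λ sub {j} {i} → sub j i) (λ sub j i → sub {j} {i})
    (Fin.all? λ j → Fin.all? λ i → H? j i →-dec G? j i)

  fixes? : ∀ w f → Dec (Fixes {n} w f)
  fixes? w f = all-dec (search-State n) λ x → f (updates f w x) ≟ᵛ updates f w x

  module _ {f g : Network n} (f≗g : f ≗ g) where

    monotone-resp : Monotone g → Monotone f
    monotone-resp mono {x} {y} x≤y = subst₂ _≤ᵛ_ (sym (f≗g x)) (sym (f≗g y)) (mono x≤y)

    interactionGraph-resp : IsSubgraph (interactionGraph f) (interactionGraph g)
    interactionGraph-resp {j} {i} (x , y , differ , fx≢fy) = x , y , differ ,
      subst₂ (λ u v → lookup u i ≢ lookup v i) (f≗g x) (f≗g y) fx≢fy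

    updates-resp : ∀ w → updates f w ≗ updates g w
    updates-resp []      x = refl
    updates-resp (i ∷ w) x rewrite f≗g x = updates-resp w _

    fixes-resp : ∀ {w} → Fixes w f → Fixes w g
    fixes-resp {w} fixes x = begin
      g (updates g w x) ≡⟨ f≗g _ ⟨
      f (updates g w x) ≡⟨ cong f (updates-resp w x) ⟨
      f (updates f w x) ≡⟨ fixes x ⟩
      updates f w x     ≡⟨ updates-resp w x ⟩
      updates g w x     ∎
      where open ≡-Reasoning

  -- All conditions respect pointwise equality of networks, and each network agrees pointwise with
  -- one given by a table, so finitely many tests decide.
  fixesMonotoneOn? : ∀ {G : Digraph n} → Decidable G → Unary.Decidable (FixesMonotoneOn G)
  fixesMonotoneOn? {G} G? w = map′ fromTables (λ fixes t → fixes ⟦ t ⟧)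
    (all-dec (search-Table n (search-State n)) λ t →
      monotone? ⟦ t ⟧ →-dec (subgraph? {G = G} (interactionGraph? ⟦ t ⟧) G? →-dec fixes? w ⟦ t ⟧))
    where
    fromTables : (∀ t → Monotone ⟦ t ⟧ → IsSubgraph (interactionGraph ⟦ t ⟧) G → Fixes w ⟦ t ⟧) →
      FixesMonotoneOn G w
    fromTables fixes f mono sub = fixes-resp {⟦ table f ⟧} {f} (⟦table⟧ f) {w}
      (fixes (table f) (monotone-resp (⟦table⟧ f) mono) (sub ∘ interactionGraph-resp (⟦table⟧ f)))

module _ {A : Set} (search : Searchable A) {P : Pred (List A) 0ℓ} (P? : Unary.Decidable P) where

  all-of-length? : ∀ k → Dec (∀ xs → length xs ≡ k → P xs)
  all-of-length? k = map′
    (λ ∀v → λ { xs refl → subst P (Vec.toList∘fromList xs) (∀v (fromList xs)) })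
    (λ ∀xs v → ∀xs (toList v) (Vec.length-toList v))
    (all-dec (search-Vec search k) (P? ∘ toList))

  any-of-length? : Unary.Decidable (λ k → ∃[ xs ] P xs × length xs ≡ k)
  any-of-length? k = map′
    (λ (v , Pv) → toList v , Pv , Vec.length-toList v)
    (λ { (xs , Pxs , refl) → fromList xs , subst P (sym (Vec.toList∘fromList xs)) Pxs })
    (search-Vec search k (P? ∘ toList))

-- A witness that is not minimal is replaced by a smaller one, found by bounded search.
minimum-exists : ∀ {P : ℕ → Set} → Unary.Decidable P → ∀ k → P k → ∃[ m ] m IsMinimumOf P
minimum-exists {P} P? = <-rec _ λ k rec Pk → descend k rec Pk (ℕ.anyUpTo? P? k)
  where
  descend : ∀ k → (∀ {j} → j < k → P j → ∃[ m ] m IsMinimumOf P) → P k →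
    Dec (∃ λ j → j < k × P j) → ∃[ m ] m IsMinimumOf P
  descend k rec Pk (yes (j , j<k , Pj)) = rec j<k Pj
  descend k rec Pk (no none) = k , Pk , λ Pm → ℕ.≮⇒≥ λ m<k → none (_ , m<k , Pm)

module _ {A : Set} (_≟_ : DecidableEquality A) where

  ↭-dec : Decidable (_↭_ {A = A})
  ↭-dec []       []       = yes ↭-refl
  ↭-dec []       (y ∷ ys) = no (¬x∷xs↭[] ∘ ↭-sym)
  ↭-dec (x ∷ xs) ys with any? (x ≟_) ys
  ... | no  x∉ys = no λ p → x∉ys (∈-resp-↭ p (here refl))
  ... | yes x∈ys with ∈-∃++ x∈ys
  ...   | as , bs , refl = map′
          (λ xs↭ → ↭-trans (prep x xs↭) (↭-sym (shift x as bs)))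
          (λ p → drop-∷ (↭-trans p (shift x as bs)))
          (↭-dec xs (as ++ bs))

-- Permutations of `allFin (α + i)` have length `α + i`, so only finitely many lists have to be
-- tested.
isComplete? : ∀ i α → Unary.Decidable (IsComplete i α)
isComplete? i α w = map′
  (λ h p p↭ → h p (trans (↭-length p↭) (length-tabulate id)) p↭)
  (λ c p _ → c p)
  (all-of-length? Fin.any?
    (λ p → ↭-dec Fin._≟_ p (allFin (α + i)) →-dec (linked? ascends? p →-dec (p ⊆? w))) (α + i))
  where
  open DecSublist (Fin._≟_ {α + i}) using (_⊆?_)
  ascends? : Decidable (AscendsWithin {α + i} α)
  ascends? j k = (toℕ j ℕ.<? α) →-dec ((toℕ k ℕ.<? α) →-dec (j Fin.<? k))

-- Complete words from repeated ascending words

-- Equal heads are matched. Otherwise the head `y` is smaller than `x`, so it occurs nowhere in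
-- `x ∷ xs` and can be skipped.
ascending-⊆ : ∀ {m} {xs ys : List (Fin m)} → AllPairs Fin._<_ xs → AllPairs Fin._<_ ys → All (_∈ ys) xs → xs ⊆ ys
ascending-⊆ {ys = ys} [] _ _ = minimum ys
ascending-⊆ {xs = x ∷ xs} (x< ∷ ascx) (y< ∷ ascy) (here refl ∷ xs∈) =
  refl ∷ ascending-⊆ ascx ascy (All.zipWith (λ (x<z , z∈) →
    Any.tail (λ { refl → Fin.<-irrefl refl x<z }) z∈) (x< , xs∈))
ascending-⊆ {xs = x ∷ xs} {y ∷ ys} (x< ∷ ascx) (y< ∷ ascy) (there x∈ ∷ xs∈) =
  y ∷ʳ ascending-⊆ (x< ∷ ascx) ascy (x∈ ∷ All.zipWith (λ (x<z , z∈) →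
    Any.tail (λ { refl → Fin.<-asym x<z (All.lookup y< x∈) }) z∈) (x< , xs∈))

module _ {m : ℕ} (α : ℕ) where

  large? : Unary.Decidable (λ (k : Fin m) → ¬ toℕ k < α)
  large? k = ¬? (toℕ k ℕ.<? α)

  larges : Word m → ℕ
  larges = length ∘ filter large?

  -- The block extends through the first large letter. Up to there it ascends: adjacent small
  -- letters do so by hypothesis, and a small letter lies below every large one. What is left has
  -- lost a large letter unless it is empty.
  ascending-block : ∀ x p → Linked (AscendsWithin α) (x ∷ p) →
    ∃[ l ] ∃[ r ] p ≡ l ++ r × Linked Fin._<_ (x ∷ l) × Linked (AscendsWithin α) r ×
    (r ≡ [] ⊎ larges r < larges (x ∷ p))
  ascending-block x [] _ = [] , [] , refl , [-] , [] , inj₁ refl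
  ascending-block x (y ∷ p) (x⇝y ∷ linked) with toℕ x ℕ.<? α
  ... | no x≮α = [] , y ∷ p , refl , [-] , linked ,
    inj₂ (ℕ.≤-reflexive (cong length (sym (filter-accept large? x≮α))))
  ... | yes x<α =
    let l , r , p≡ , asc , linked′ , smaller = ascending-block y p linked
    in y ∷ l , r , cong (y ∷_) p≡ , x<y ∷ asc , linked′ ,
      Sum.map₂ (λ fewer → ℕ.<-≤-trans fewer
        (ℕ.≤-reflexive (cong length (sym (filter-reject large? (_$ x<α)))))) smaller
    where
    x<y : x Fin.< y
    x<y with toℕ y ℕ.<? α
    ... | yes y<α = x⇝y x<α y<α
    ... | no  y≮α = ℕ.<-≤-trans x<α (ℕ.≮⇒≥ y≮α)

  copies : ℕ → Word m
  copies c = concat (replicate c (allFin m))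

  length-copies : ∀ c → length (copies c) ≡ c * m
  length-copies zero    = refl
  length-copies (suc c) = trans (length-++ (allFin m)) (cong₂ _+_ (length-tabulate id) (length-copies c))

  -- Every ascending block fits into one copy, and each block but the last uses up a large letter:
  -- `c` large letters give at most `c + 1` blocks.
  ⊆-copies : ∀ c p → larges p ≤ c → Linked (AscendsWithin α) p → p ⊆ copies (suc c)
  ⊆-copies c []      _ _ = minimum _
  ⊆-copies c (x ∷ p) few linked with ascending-block x p linked
  ... | l , r , refl , asc , linked′ , smaller = Sublist.++⁺
          (ascending-⊆ (Linked.Linked⇒AllPairs Fin.<-trans asc) (AllPairs.tabulate⁺-< id) (All.universal ∈-allFin _))
          (rest c few smaller)
    where
    rest : ∀ c → larges (x ∷ p) ≤ c → r ≡ [] ⊎ larges r < larges (x ∷ p) → r ⊆ copies c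
    rest c few (inj₁ refl) = minimum _
    rest zero few (inj₂ fewer) = contradiction (ℕ.<-≤-trans fewer few) λ ()
    rest (suc c) few (inj₂ fewer) = ⊆-copies c r (ℕ.≤-pred (ℕ.<-≤-trans fewer few)) linked′

larges-allFin : ∀ α i → larges α (allFin (α + i)) ≤ i
larges-allFin zero    i = ℕ.≤-trans (length-filter (large? 0) (allFin i)) (ℕ.≤-reflexive (length-tabulate id))
larges-allFin (suc α) i = ℕ.≤-trans (ℕ.≤-reflexive (begin
  larges (suc α) (tabulate {n = α + i} suc)     ≡⟨ cong (larges (suc α)) (map-tabulate {n = α + i} id suc) ⟨
  larges (suc α) (map suc (allFin (α + i)))     ≡⟨ length-filter-map (large? (suc α)) (large? α) suc
                                                     (_∘ s<s) (_∘ s<s⁻¹) (allFin (α + i)) ⟩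
  larges α (allFin (α + i))                     ∎)) (larges-allFin α i)
  where open ≡-Reasoning

copies-complete : ∀ i α → IsComplete i α (copies α (suc i))
copies-complete i α p p↭ linked = ⊆-copies α i p
  (ℕ.≤-trans (ℕ.≤-reflexive (↭-length (filter-↭ (large? α) p↭))) (larges-allFin α i)) linked

shortestComplete : ∀ i α → ∃[ l ] IsShortestCompleteLength i α l
shortestComplete i α = minimum-exists (any-of-length? Fin.any? (isComplete? i α)) _
  (copies α (suc i) , copies-complete i α , refl)

λᶜ : ℕ → ℕ → ℕ
λᶜ i α = proj₁ (shortestComplete i α)

λᶜ-upper : ∀ i α → λᶜ i α ≤ suc i * (α + i)
λᶜ-upper i α = proj₂ (proj₂ (shortestComplete i α)) (copies α (suc i) , copies-complete i α , length-copies α (suc i))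

-- The numerical bound

-- The summand for `i` is at most `(i + 1) * n`, as `α + i ≤ n`, and the numbers from 1 to `t` add
-- up to `t * (t + 1) / 2`. Doubling avoids the division.
double-sum-upper : ∀ {n} α t → α + t ≤ n → 2 * sum (applyUpTo (λ i → λᶜ i α) t) ≤ t * suc t * n
double-sum-upper α zero _ = ℕ.≤-refl
double-sum-upper {n} α (suc t) α+1+t≤n = begin
  2 * sum (applyUpTo l (suc t))
    ≡⟨ cong (2 *_) (sum-applyUpTo-suc l t) ⟩
  2 * (sum (applyUpTo l t) + l t)
    ≡⟨ ℕ.*-distribˡ-+ 2 (sum (applyUpTo l t)) (l t) ⟩
  2 * sum (applyUpTo l t) + 2 * l t
    ≤⟨ ℕ.+-mono-≤ (double-sum-upper α t α+t≤n)
         (ℕ.*-monoʳ-≤ 2 (ℕ.≤-trans (λᶜ-upper t α) (ℕ.*-monoʳ-≤ (suc t) α+t≤n))) ⟩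
  t * suc t * n + 2 * (suc t * n)
    ≡⟨ solve 2 (λ t n → t :* (con 1 :+ t) :* n :+ con 2 :* ((con 1 :+ t) :* n)
                     := (con 1 :+ t) :* (con 2 :+ t) :* n) refl t n ⟩
  suc t * suc (suc t) * n ∎
  where
  open ℕ.≤-Reasoning
  open +-*-Solver
  l = λ i → λᶜ i α
  α+t≤n = ℕ.≤-trans (ℕ.+-monoʳ-≤ α (ℕ.n≤1+n t)) α+1+t≤n

-- The inequality of rational-bound with the denominators cleared in the way ℚᵘ does it.
cleared-bound : ∀ τ n s → 2 * s ≤ τ * suc τ * n →
  (n + s) * 4 ≤ ((τ ^ 2 * 2 + 3 * τ * 2) * 1 + 1 * 4) * n * 1
cleared-bound τ n s 2s≤ = begin
  (n + s) * 4
    ≡⟨ solve 2 (λ n s → (n :+ s) :* con 4 := con 4 :* n :+ con 2 :* (con 2 :* s)) refl n s ⟩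
  4 * n + 2 * (2 * s)
    ≤⟨ ℕ.+-monoʳ-≤ (4 * n) (ℕ.*-monoʳ-≤ 2 2s≤) ⟩
  4 * n + 2 * (τ * suc τ * n)
    -- The estimate so far is four times `n + τ * (τ + 1) / 2 * n`; the stated bound exceeds the
    -- latter by `τ * n`.
    ≤⟨ ℕ.m≤m+n _ (4 * τ * n) ⟩
  4 * n + 2 * (τ * suc τ * n) + 4 * τ * n
    ≡⟨ solve 2 (λ t n →
         con 4 :* n :+ con 2 :* (t :* (con 1 :+ t) :* n) :+ con 4 :* t :* n :=
         ((t :^ 2 :* con 2 :+ con 3 :* t :* con 2) :* con 1 :+ con 1 :* con 4) :* n :* con 1) refl τ n ⟩
  ((τ ^ 2 * 2 + 3 * τ * 2) * 1 + 1 * 4) * n * 1 ∎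
  where
  open ℕ.≤-Reasoning
  open +-*-Solver

-- Unnormalised fractions have explicit numerators and denominators, so there the claim becomes an
-- inequality of integers.
rational-bound : ∀ τ n {N s} → N ≡ n + s → 2 * s ≤ τ * suc τ * n →
  (+ N / 1) ℚ.≤ ((+ (τ ^ 2) / 2) ℚ.+ (+ (3 * τ) / 2) ℚ.+ 1ℚ) ℚ.* (+ n / 1)
rational-bound τ n {N} {s} refl 2s≤ = ℚ.toℚᵘ-cancel-≤ (begin
  toℚᵘ (+ N / 1)
    ≃⟨ ℚ.toℚᵘ-fromℚᵘ (mkℚᵘ (+ N) 0) ⟩
  mkℚᵘ (+ N) 0
    ≤⟨ ℚᵘ.*≤* integer-bound ⟩
  (a ℚᵘ.+ b ℚᵘ.+ ℚᵘ.1ℚᵘ) ℚᵘ.* c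
    ≃⟨ ℚᵘ.*-cong (ℚᵘ.+-congˡ ℚᵘ.1ℚᵘ (ℚᵘ.+-cong (ℚ.toℚᵘ-fromℚᵘ a) (ℚ.toℚᵘ-fromℚᵘ b))) (ℚ.toℚᵘ-fromℚᵘ c) ⟨
  (toℚᵘ p ℚᵘ.+ toℚᵘ q ℚᵘ.+ ℚᵘ.1ℚᵘ) ℚᵘ.* toℚᵘ r
    ≃⟨ ℚᵘ.*-congʳ (ℚᵘ.≃-trans (ℚ.toℚᵘ-homo-+ (p ℚ.+ q) 1ℚ) (ℚᵘ.+-congˡ ℚᵘ.1ℚᵘ (ℚ.toℚᵘ-homo-+ p q))) ⟨
  toℚᵘ (p ℚ.+ q ℚ.+ 1ℚ) ℚᵘ.* toℚᵘ r
    ≃⟨ ℚ.toℚᵘ-homo-* (p ℚ.+ q ℚ.+ 1ℚ) r ⟨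
  toℚᵘ ((p ℚ.+ q ℚ.+ 1ℚ) ℚ.* r) ∎)
  where
  open ℚᵘ.≤-Reasoning
  p = + (τ ^ 2) / 2
  q = + (3 * τ) / 2
  r = + n / 1
  a = mkℚᵘ (+ (τ ^ 2)) 1
  b = mkℚᵘ (+ (3 * τ)) 1
  c = mkℚᵘ (+ n) 0

  integer-bound :
    + N ℤ.* + 4 ℤ.≤
    ((+ (τ ^ 2) ℤ.* + 2 ℤ.+ + (3 * τ) ℤ.* + 2) ℤ.* + 1 ℤ.+ + 1 ℤ.* + 4) ℤ.* + n ℤ.* + 1
  -- The rewrites collect products of nonnegative integers under a single `+_`, turning the claim
  -- into one about naturals.
  integer-bound rewrite sym (ℤ.pos-* (τ ^ 2) 2) | sym (ℤ.pos-* (3 * τ) 2)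
    | sym (ℤ.pos-* (τ ^ 2 * 2 + 3 * τ * 2) 1)
    | sym (ℤ.pos-* ((τ ^ 2 * 2 + 3 * τ * 2) * 1 + 1 * 4) n)
    | sym (ℤ.pos-* (((τ ^ 2 * 2 + 3 * τ * 2) * 1 + 1 * 4) * n) 1)
    | sym (ℤ.pos-* N 4) = ℤ.+≤+ (cleared-bound τ n s 2s≤)

-- From a feedback vertex set to the theorem

feedback-split : ∀ {n} {G : Digraph n} → Decidable G → ∀ {I} → IsFeedbackVertexSet₁ G I →
  ∃[ U ] ∃[ J ] U ++ J ↭ allFin n × AllPairs (NoEdgeBack G) U × length J ≡ ∣ I ∣
feedback-split {n} G? {I} feedback =
  let rest = filter (¬? ∘ (_∈? I)) (allFin n)
      J    = filter (_∈? I) (allFin n)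
      U , U↭rest , topU = topologicalSort G? feedback _ rest refl
        (Unique.filter⁺ (¬? ∘ (_∈? I)) (Unique.allFin⁺ n)) (All.all-filter (¬? ∘ (_∈? I)) (allFin n))
  in U , J
   , ↭-trans (++-comm U J) (↭-trans (++⁺ˡ J U↭rest) (filter-++-filter (_∈? I) (allFin n)))
   , topU , length-filter-∈ I

short-fixing-word : ∀ {n} {G : Digraph n} U J → U ++ J ↭ allFin n → AllPairs (NoEdgeBack G) U →
  ∃[ w ] FixesMonotoneOn G w × length w ≡ n + sum (applyUpTo (λ i → λᶜ i (length U)) (length J))
short-fixing-word {n} {G} U J UJ↭ topU = w , fixes , length-w
  where
  α = length U
  ω : ∀ i → Word (α + i)
  ω i = proj₁ (proj₁ (proj₂ (shortestComplete i α)))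
  complete : ∀ i → IsComplete i α (ω i)
  complete i = proj₁ (proj₂ (proj₁ (proj₂ (shortestComplete i α))))
  length-ω : ∀ i → length (ω i) ≡ λᶜ i α
  length-ω i = proj₂ (proj₂ (proj₁ (proj₂ (shortestComplete i α))))

  topU′ : AllPairs (NoEdgeBack G) (toList (fromList U))
  topU′ = subst (AllPairs (NoEdgeBack G)) (sym (Vec.toList∘fromList U)) topU

  w = fixingWord (fromList U) ω (fromList J)

  fixes : FixesMonotoneOn G w
  fixes f mono sub x = lookup-injective λ k → stable k (∈-++⁻ U (∈-resp-↭ (↭-sym UJ↭) (∈-allFin k)))
    where
    stableUJ = fixingWord-stable (fromList U) ω complete topU′ mono sub (fromList J) x
    stable : ∀ k → k ∈ U ⊎ k ∈ J → Stable f (updates f w x) k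
    stable k (inj₁ k∈U) = All.lookup (VecAll.fromList⁻ (proj₁ stableUJ)) k∈U
    stable k (inj₂ k∈J) = All.lookup (VecAll.fromList⁻ (proj₂ stableUJ)) k∈J

  length-w : length w ≡ n + sum (applyUpTo (λ i → λᶜ i α) (length J))
  length-w = trans (length-fixingWord (fromList U) ω (fromList J))
    (cong₂ _+_ (trans (sym (length-++ U)) (trans (↭-length UJ↭) (length-tabulate id)))
      (cong sum (applyUpTo-cong length-ω (length J))))

feedback-fixing-word : ∀ {n} {G : Digraph n} → Decidable G → ∀ {I} → IsFeedbackVertexSet₁ G I →
  ∃[ w ] FixesMonotoneOn G w × length w ≡ n + sum (applyUpTo (λ i → λᶜ i (n ∸ ∣ I ∣)) ∣ I ∣)
feedback-fixing-word {n} G? {I} feedback =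
  let U , J , UJ↭ , topU , ∣J∣≡∣I∣ = feedback-split G? feedback
      w , fixes , length-w = short-fixing-word U J UJ↭ topU
      n≡∣U∣+∣J∣ = trans (sym (length-tabulate id)) (trans (sym (↭-length UJ↭)) (length-++ U))
      ∣U∣≡ = trans (sym (ℕ.m+n∸n≡m (length U) (length J))) (cong₂ _∸_ (sym n≡∣U∣+∣J∣) ∣J∣≡∣I∣)
  in w , fixes , trans length-w (cong₂ (λ a t → n + sum (applyUpTo (λ i → λᶜ i a) t)) ∣U∣≡ ∣J∣≡∣I∣)

-- The minima are exhibited; by `minimum-unique` no other values are possible, so this speaks of λ
-- and λ_M themselves. Decidable edges serve the sorting and the search for λ_M.
theorem13 : ∀ n (G : Digraph n) → Decidable G →
    ∀ τ₁ → IsTransversalNumber₁ G τ₁ →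
    Σ[ lam ∈ (ℕ → ℕ → ℕ) ] Σ[ λM ∈ ℕ ]
    (∀ i α → IsShortestCompleteLength i α (lam i α)) ×
    IsMonotoneFixingLength G λM ×
    (λM ≤ n + sum (map (λ i → lam (i ∸ 1) (n ∸ τ₁)) (applyUpTo suc τ₁))) ×
    ((+ (n + sum (map (λ i → lam (i ∸ 1) (n ∸ τ₁)) (applyUpTo suc τ₁))) / 1)
    ℚ.≤ ((+ (τ₁ ^ 2) / 2) ℚ.+ (+ (3 * τ₁) / 2) ℚ.+ 1ℚ) ℚ.* (+ n / 1))
theorem13 n G G? _ ((I , feedback , refl) , _) =
  let w , fixes , length-w = feedback-fixing-word G? feedback
      λM , λM-minimum = minimum-exists (any-of-length? Fin.any? (fixesMonotoneOn? G?)) _ (w , fixes , refl)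
      -- Passes from the sum over 1, ..., τ₁ to the one starting at 0, where `suc i ∸ 1` reduces to
      -- `i`.
      sums≡ = cong (λ xs → n + sum xs) (map-applyUpTo suc (λ i → λᶜ (i ∸ 1) (n ∸ ∣ I ∣)) ∣ I ∣)
  in λᶜ , λM , (λ i α → proj₂ (shortestComplete i α)) , λM-minimum
   , ℕ.≤-trans (proj₂ λM-minimum (w , fixes , refl)) (ℕ.≤-reflexive (trans length-w (sym sums≡)))
   , rational-bound ∣ I ∣ n sums≡
       (double-sum-upper (n ∸ ∣ I ∣) ∣ I ∣ (ℕ.≤-reflexive (ℕ.m∸n+n≡m (∣p∣≤n I))))
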